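{- Let $T$ be a colored triangulation of a combinatorial polygon. If the boundary word $\mathrm{Word}(T)$ is not contractible, then $T$ contains a tricolor triangle.
   Context: For $n\ge 3$, a combinatorial $n$-gon is an abstract cycle graph $G$ with $n$ vertices; a combinatorial polygon is a combinatorial $n$-gon for some $n\ge 3$. A triangulation of a combinatorial polygon $G$ is a finite collection $T$ of 3-element sets, called triangles, such that the underlying space $|T|$ (the topological space obtained by taking one geometric triangle for each element of $T$ and gluing them along common vertices and common edges, i.e. the geometric realization of the simplicial complex generated by $T$) is a topological disk whose boundary is equal to $G$. The vertices of $G$ are called the corners of $T$; $T$ may have additional (interior) vertices. A colored triangulation of $G$ is a triangulation $T$ of $G$ together with an assignment of a color (an element of an arbitrary set) to each vertex of $T$. The boundary word $\mathrm{Word}(T)$ is the cyclic word consisting of the colors of the corners, in cyclic order around $G$ (well defined up to reversal, which is immaterial). A colored triangle is tricolor if its three vertices have three different colors. A cyclic word $(X_1X_2\ldots X_n)$ is a finite string of letters considered up to cyclic permutation; indices are modulo $n$. For $n\ge 2$, a contracting step is: if the letters $X_{i-1},X_i,X_{i+1}$ are not all distinct, delete $X_i$. A cyclic word is contractible if there is a (possibly empty) sequence of contracting steps starting with it that results in a word consisting of a single letter. -}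

module Defs where

open import Level using (Level; 0ℓ; _⊔_) renaming (suc to lsuc)
open import Algebra.Bundles using (CommutativeRing)
open import Data.Fin.Base using (Fin; zero; suc)
open import Data.List.Base using (List; []; _∷_; _++_; map; foldr; length)
open import Data.List.Membership.Propositional using (_∈_; _∉_)
open import Data.List.NonEmpty using (last) renaming (_∷_ to _∷⁺_)
open import Data.List.Relation.Unary.Unique.Propositional using (Unique)
open import Data.Nat.Base as ℕ using (ℕ)
open import Data.Product.Base using (Σ; ∃; _×_; _,_; proj₁)
open import Function.Bundles using (_⇔_)
open import Relation.Binary.Construct.Closure.ReflexiveTransitive using (Star)
open import Relation.Binary.Core using (Rel)
import Relation.Binary.Construct.NonStrictToStrict as NonStrictToStrict
open import Relation.Binary.PropositionalEquality.Core using (_≡_)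
open import Relation.Binary.Structures using (IsTotalOrder)
open import Relation.Nullary.Negation.Core using (¬_)
open import Relation.Unary using (Pred)

private
  variable
    a b c i j v : Level

------------------------------------------------------------------------
-- Cyclic words

-- A cyclic word is represented by any of its linear readings; two lists
-- read the same cyclic word when they are related by _∼_.

data _∼_ {A : Set a} : Rel (List A) a where
  rotation : ∀ xs ys → (xs ++ ys) ∼ (ys ++ xs)

-- Rotating the deleted letter Xᵢ = x to the front puts Xᵢ₊₁ = y second
-- and Xᵢ₋₁ last. In a word of two letters these two neighbours coincide,
-- so either letter may be deleted.

data _⟶_ {C : Set c} : Rel (List C) c where
  contract : ∀ {w x y zs} →
             w ∼ (x ∷ y ∷ zs) →
             ¬ Unique (last (y ∷⁺ zs) ∷ x ∷ y ∷ []) →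
             w ⟶ (y ∷ zs)

Contractible : {C : Set c} → Pred (List C) c
Contractible w = ∃ λ x → Star _⟶_ w (x ∷ [])

------------------------------------------------------------------------
-- Polygons and triangles

-- The vertices of the polygon, listed in cyclic order.

record Polygon (V : Set v) : Set v where
  field
    corners  : List V
    distinct : Unique corners
    3≤length : 3 ℕ.≤ length corners

-- A 3-element set; nothing below depends on the order in which its
-- elements are listed.

record Triangle (V : Set v) : Set v where
  field
    v₀ v₁ v₂ : V

  vertices : List V
  vertices = v₀ ∷ v₁ ∷ v₂ ∷ []

  field
    distinct : Unique vertices

open Polygon public using (corners)
open Triangle public using (vertices)

data IsEdge {V : Set v} (G : Polygon V) : Pred (List V) v where
  edge : ∀ {x y zs} → corners G ∼ (x ∷ y ∷ zs) → IsEdge G (x ∷ y ∷ [])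

data IsTriangle {V : Set v} (T : List (Triangle V)) : Pred (List V) v where
  triangle : ∀ {t} → t ∈ T → IsTriangle T (vertices t)

word : {V : Set v} {C : Set c} → (V → C) → Polygon V → List C
word colour G = map colour (corners G)

Tricolor : {V : Set v} {C : Set c} → (V → C) → Pred (Triangle V) c
Tricolor colour t = Unique (map colour (vertices t))

------------------------------------------------------------------------
-- The real numbers

-- Dedekind-complete totally ordered fields: classically, ℝ is the only
-- one up to isomorphism.

record CompleteOrderedField : Set₁ where
  infix 4 _≤_
  field
    commutativeRing : CommutativeRing 0ℓ 0ℓ

  open CommutativeRing commutativeRing public

  field
    _≤_          : Rel Carrier 0ℓ
    isTotalOrder : IsTotalOrder _≈_ _≤_
    0≉1          : ¬ 0# ≈ 1#
    inverse      : ∀ x → ¬ x ≈ 0# → ∃ λ y → x * y ≈ 1#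
    +-monoˡ-≤    : ∀ {x y} z → x ≤ y → x + z ≤ y + z
    *-nonNeg     : ∀ {x y} → 0# ≤ x → 0# ≤ y → 0# ≤ x * y

  UpperBound : Pred Carrier 0ℓ → Pred Carrier 0ℓ
  UpperBound P u = ∀ x → P x → x ≤ u

  field
    supremum : (P : Pred Carrier 0ℓ) → ∃ P → ∃ (UpperBound P) →
               ∃ λ s → UpperBound P s × (∀ u → UpperBound P u → s ≤ u)

  open NonStrictToStrict _≈_ _≤_ public using (_<_)

------------------------------------------------------------------------
-- Topological disks

module Topology (ℝ : CompleteOrderedField) where
  open CompleteOrderedField ℝ hiding (zero)

  -- Subsets of ℝᴵ carry the topology of uniform convergence. On the
  -- subsets used below, whose points are supported in a fixed finite
  -- set of coordinates, this is the Euclidean topology.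

  Point : {I : Set i} → Pred (I → Carrier) a → Set (i ⊔ a)
  Point A = Σ _ A

  Near : {I : Set i} → Carrier → Rel (I → Carrier) i
  Near ε p q = ∀ k → (p k - q k < ε) × (q k - p k < ε)

  -- Continuous functions automatically respect _≈_.

  Continuous : {I : Set i} {J : Set j}
               {A : Pred (I → Carrier) a} {B : Pred (J → Carrier) b} →
               (Point A → Point B) → Set (i ⊔ j ⊔ a)
  Continuous f = ∀ p ε → 0# < ε → ∃ λ δ → 0# < δ ×
    (∀ q → Near δ (proj₁ p) (proj₁ q) → Near ε (proj₁ (f p)) (proj₁ (f q)))

  record Homeomorphism {I : Set i} {J : Set j}
                       (A : Pred (I → Carrier) a) (B : Pred (J → Carrier) b) :
                       Set (i ⊔ j ⊔ a ⊔ b) where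
    field
      to              : Point A → Point B
      from            : Point B → Point A
      to-continuous   : Continuous {A = A} {B = B} to
      from-continuous : Continuous {A = B} {B = A} from
      to∘from         : ∀ q k → proj₁ (to (from q)) k ≈ proj₁ q k
      from∘to         : ∀ p k → proj₁ (from (to p)) k ≈ proj₁ p k

  norm² : (Fin 2 → Carrier) → Carrier
  norm² p = p zero * p zero + p (suc zero) * p (suc zero)

  Disk : Pred (Fin 2 → Carrier) 0ℓ
  Disk p = norm² p ≤ 1#

  Circle : Pred (Fin 2 → Carrier) 0ℓ
  Circle p = norm² p ≈ 1#

  -- Barycentric coordinates; σ lists the vertices without repetition.

  Simplex : {V : Set v} → List V → Pred (V → Carrier) v
  Simplex σ p = (∀ x → 0# ≤ p x)
              × (∀ x → x ∉ σ → p x ≈ 0#)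
              × foldr _+_ 0# (map p σ) ≈ 1#

  -- The geometric realization of the complex generated by the simplices
  -- in K: gluing along common faces is automatic, because points are
  -- identified by their barycentric coordinates.

  ∣_∣ : {V : Set v} → Pred (List V) v → Pred (V → Carrier) v
  ∣ K ∣ p = ∃ λ σ → K σ × Simplex σ p

  -- The last field says that the homeomorphism restricts to one between
  -- ∣G∣ and the boundary circle. As it forces every point of ∣G∣ to lie
  -- in ∣T∣, it also makes the edges of G edges of T.

  record IsTriangulation {V : Set v} (G : Polygon V) (T : List (Triangle V)) :
                         Set v where
    field
      homeomorphism : Homeomorphism ∣ IsTriangle T ∣ Disk

    open Homeomorphism homeomorphism

    field
      boundary : ∀ p → ∣ IsEdge G ∣ p ⇔
                 Σ (∣ IsTriangle T ∣ p) λ p∈T → Circle (proj₁ (to (p , p∈T)))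

open Topology public using (IsTriangulation)

{-# OPTIONS --safe #-}
module Submission where

-- Suppose that there is no tricolor triangle, and give each point of the
-- disk the colours of the vertices of T that are heavy in its barycentric
-- coordinates. By continuity, three colours of points of a small ball
-- are never all different. Walks in the complete graph on the colours have
-- reduced forms, which do not change when a letter is inserted or deleted
-- by a contracting step; so the reduced word read along the segment from a
-- fixed corner of the disk to a point that moves along the boundary changes
-- only by appending the colour of that point. After one turn around the
-- boundary the reduced word is trivial again, and reducing the boundary
-- word letter by letter is a sequence of contracting steps.

open import Defs
open import Algebra.Bundles using (CommutativeRing; RawRing)
import Algebra.Properties.AbelianGroup
import Algebra.Properties.Ring
import Algebra.Properties.Semiring.Mult.TCOptimised
import Algebra.Solver.Ring
import Algebra.Solver.Ring.NaturalCoefficients.Default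
open import Algebra.Solver.Ring.AlmostCommutativeRing
  using (fromCommutativeRing; _-Raw-AlmostCommutative⟶_)
open import Axiom.ExcludedMiddle using (ExcludedMiddle)
open import Data.Fin.Base using (Fin; zero; suc)
open import Data.List.Base
  using (List; []; _∷_; _++_; [_]; _∷ʳ_; map; reverse; foldl; length; initLast; _∷ʳ′_)
open import Data.List.Membership.Propositional using (_∈_; _∉_)
open import Data.List.Membership.Propositional.Properties using (∈-map⁺)
open import Data.List.NonEmpty using (last) renaming (_∷_ to _∷⁺_)
open import Data.List.Properties
  using (++-assoc; ++-identityʳ; ++-conicalʳ; unfold-reverse; ∷-injectiveʳ; ∷ʳ-injective; foldl-∷ʳ; map-++)
import Data.List.Relation.Binary.Permutation.Setoid.Properties as Permutation
open import Data.List.Relation.Unary.All using ([]; _∷_)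
open import Data.List.Relation.Unary.AllPairs using ([]; _∷_)
open import Data.List.Relation.Unary.Any using (here; there)
open import Data.List.Relation.Unary.Linked using (Linked; [-]; _∷_)
open import Data.List.Relation.Unary.Unique.Propositional using (Unique)
open import Data.Maybe.Base using (Maybe; just; nothing)
open import Data.Nat.Base as ℕ using (ℕ)
import Data.Nat.Properties as ℕ
open import Data.Product.Base using (Σ; ∃; _×_; _,_; proj₁; proj₂)
open import Data.Sum.Base using (_⊎_; inj₁; inj₂)
open import Function.Base using (case_of_)
open import Function.Bundles using (Equivalence)
open import Level using (_⊔_)
open import Relation.Binary.Construct.Closure.ReflexiveTransitive using (Star; ε; _◅_; _◅◅_)
open import Relation.Binary.Core using (Rel)
open import Relation.Binary.Definitions using (DecidableEquality)
open import Relation.Binary.PropositionalEquality as ≡ using (_≡_; _≢_)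
import Relation.Binary.Reasoning.Setoid
open import Relation.Binary.Structures using (IsTotalOrder)
open import Relation.Nullary.Decidable using (Dec; yes; no; True; toWitness; fromWitness)
open import Relation.Nullary.Negation using (¬_; contradiction)
open import Relation.Unary using (Pred; _⊆_)

-- Degenerate triples of colours and contraction of cyclic words.

module _ {c} {C : Set c} where
  open ≡ using (refl; sym; trans; subst)

  Degenerate : C → C → C → Set c
  Degenerate x y z = ¬ Unique (x ∷ y ∷ z ∷ [])

  Flat : ∀ {p} → Pred C p → Set (c ⊔ p)
  Flat P = ∀ X Y Z → P X → P Y → P Z → Degenerate X Y Z

  flat-⊆ : ∀ {p q} {P : Pred C p} {Q : Pred C q} → P ⊆ Q → Flat Q → Flat P
  flat-⊆ P⊆Q flat X Y Z PX PY PZ = flat X Y Z (P⊆Q PX) (P⊆Q PY) (P⊆Q PZ)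

  degenerate-xyx : ∀ {x y} → Degenerate x y x
  degenerate-xyx ((_ ∷ x≢x ∷ _) ∷ _) = x≢x refl

  degenerate-xxy : ∀ {x y} → Degenerate x x y
  degenerate-xxy ((x≢x ∷ _) ∷ _) = x≢x refl

  flat-pair : ∀ a b → Flat (_∈ a ∷ b ∷ [])
  flat-pair _ _ _ _ _ (here refl) (here refl) _ = degenerate-xxy
  flat-pair _ _ _ _ _ (there (here refl)) (there (here refl)) _ = degenerate-xxy
  flat-pair _ _ _ _ _ (here refl) _ (here refl) = degenerate-xyx
  flat-pair _ _ _ _ _ (there (here refl)) _ (there (here refl)) = degenerate-xyx
  flat-pair _ _ _ _ _ _ (here refl) (here refl) (_ ∷ (y≢y ∷ _) ∷ _) = y≢y refl
  flat-pair _ _ _ _ _ _ (there (here refl)) (there (here refl)) (_ ∷ (y≢y ∷ _) ∷ _) = y≢y refl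

  initLast-∷ʳ : ∀ xs (x : C) → initLast (xs ∷ʳ x) ≡ xs ∷ʳ′ x
  initLast-∷ʳ []       x = refl
  initLast-∷ʳ (_ ∷ xs) x rewrite initLast-∷ʳ xs x = refl

  last-∷ʳ : ∀ (y : C) zs x → last (y ∷⁺ zs ∷ʳ x) ≡ x
  last-∷ʳ y zs x rewrite initLast-∷ʳ zs x = refl

  ∼-refl : ∀ {w : List C} → w ∼ w
  ∼-refl {w} = subst (w ∼_) (++-identityʳ w) (rotation [] w)

  unique-∼ : ∀ {w w′ : List C} → w ∼ w′ → Unique w → Unique w′
  unique-∼ (rotation xs ys) = Permutation.Unique-resp-↭ (≡.setoid C) (Permutation.++-comm (≡.setoid C) xs ys)

  contract-repetition : ∀ {w x} u → w ∼ (x ∷ u ∷ʳ x) → w ⟶ (u ∷ʳ x)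
  contract-repetition [] w∼ = contract w∼ degenerate-xxy
  contract-repetition {w} {x} (y ∷ u) w∼ =
    contract w∼ (subst (λ z → Degenerate z x y) (sym (last-∷ʳ y u x)) degenerate-xxy)

  contract-backtrack : ∀ {w x z} u → w ∼ (x ∷ z ∷ u ∷ʳ z) → w ⟶ (z ∷ u ∷ʳ z)
  contract-backtrack {w} {x} {z} u w∼ =
    contract w∼ (subst (λ z′ → Degenerate z′ x z) (sym (last-∷ʳ z u z)) degenerate-xyx)

  -- `_∼_` is a single rotation, so its cutting point has to be moved. If the second part is empty,
  -- `w` is `xs ∷ʳ x` itself; otherwise the second part ends in `x`, which passes to the head of the
  -- first part.
  ∼-rotate : ∀ x xs {w : List C} → (xs ∷ʳ x) ∼ w → (x ∷ xs) ∼ w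
  ∼-rotate x xs = go refl
    where
    go : ∀ {u w} → u ≡ xs ∷ʳ x → u ∼ w → (x ∷ xs) ∼ w
    go eq (rotation as bs) with initLast bs
    go eq (rotation as .[]) | [] rewrite trans (sym (++-identityʳ as)) eq =
      rotation [ x ] xs
    go eq (rotation as .(bs ∷ʳ z)) | bs ∷ʳ′ z
      with refl , refl ← ∷ʳ-injective (as ++ bs) xs (trans (++-assoc as bs [ z ]) eq)
      rewrite ++-assoc bs [ z ] as = rotation (z ∷ as) bs

  -- Every contracting step begins with a rotation, so the first step absorbs the extra one. There
  -- is a first step, because a word of two or more letters is not yet a single letter.
  contractible-rotate : ∀ x xs → Contractible (xs ∷ʳ x) → Contractible (x ∷ xs)
  contractible-rotate x []      p = p
  contractible-rotate x (y ∷ ys) (z , steps) = z , go refl steps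
    where
    go : ∀ {u} → u ≡ (y ∷ ys) ∷ʳ x → Star _⟶_ u (z ∷ []) → Star _⟶_ (x ∷ y ∷ ys) (z ∷ [])
    go eq ε with () ← ++-conicalʳ ys [ x ] (sym (∷-injectiveʳ eq))
    go refl (contract ∼w d ◅ steps) = contract (∼-rotate x (y ∷ ys) ∼w) d ◅ steps

  contractible-⟶ : ∀ {w w′ : List C} → w ⟶ w′ → Contractible w′ → Contractible w
  contractible-⟶ step (x , steps) = x , step ◅ steps

-- Reduced walks in the complete graph on the colours.

module Reduction {c} {C : Set c} (_≟_ : DecidableEquality C) where
  open ≡ using (refl; sym; trans; cong; ≢-sym)

  -- The homotopy class of a walk in the complete graph on C is represented
  -- by its reduced form, listed from the end of the walk to its start.

  push : C → List C → List C
  backtrack : C → C → List C → List C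

  push c []      = c ∷ []
  push c (x ∷ s) with c ≟ x
  ... | yes _ = x ∷ s
  ... | no  _ = backtrack c x s

  backtrack c x []      = c ∷ x ∷ []
  backtrack c x (y ∷ s) with c ≟ y
  ... | yes _ = y ∷ s
  ... | no  _ = c ∷ x ∷ y ∷ s

  -- The index is the letter at which the walk ends. Absence of backtracking means that letters two
  -- places apart differ.
  data Reduced : C → List C → Set c where
    one  : ∀ {x} → Reduced x (x ∷ [])
    two  : ∀ {x y} → Reduced x (x ∷ y ∷ [])
    more : ∀ {x y z s} → x ≢ z → Reduced y (y ∷ z ∷ s) → Reduced x (x ∷ y ∷ z ∷ s)

  push-reduced : ∀ {x s} c → Reduced x s → Reduced c (push c s)
  push-reduced {x} {.x ∷ s} c one with c ≟ x
  ... | yes refl = one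
  ... | no _     = two
  push-reduced {x} {.x ∷ y ∷ s} c r@two with c ≟ x
  ... | yes refl = r
  ... | no _ with c ≟ y
  ...   | yes refl = one
  ...   | no c≢y   = more c≢y two
  push-reduced {x} {.x ∷ y ∷ z ∷ s} c r@(more x≢z r′) with c ≟ x
  ... | yes refl = r
  ... | no _ with c ≟ y
  ...   | yes refl = r′
  ...   | no c≢y   = more c≢y r

  push-top : ∀ {x s} → Reduced x s → push x s ≡ s
  push-top {x} r with r
  ... | one with x ≟ x
  ...   | yes _ = refl
  ...   | no x≢x = contradiction refl x≢x
  push-top {x} r | two with x ≟ x
  ...   | yes _ = refl
  ...   | no x≢x = contradiction refl x≢x
  push-top {x} r | more _ _ with x ≟ x
  ...   | yes _ = refl
  ...   | no x≢x = contradiction refl x≢x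

  push-idem : ∀ {t s} x → Reduced t s → push x (push x s) ≡ push x s
  push-idem x r = push-top (push-reduced x r)

  push-≢ : ∀ {c x} s → c ≢ x → push c (x ∷ s) ≡ backtrack c x s
  push-≢ {c} {x} s c≢x with c ≟ x
  ... | yes c≡x = contradiction c≡x c≢x
  ... | no _    = refl

  backtrack-≡ : ∀ c x s → backtrack c x (c ∷ s) ≡ c ∷ s
  backtrack-≡ c x s with c ≟ c
  ... | yes _  = refl
  ... | no c≢c = contradiction refl c≢c

  -- A step from `t` to `x` and back is null-homotopic. If the step to `x` cancelled the last step
  -- of `s`, the way back restores it, and `t ≢ z` keeps it from cancelling once more.
  push-push : ∀ {t s} x → Reduced t s → push t (push x s) ≡ s
  push-push {t} {s} x r with t ≟ x
  ... | yes refl = trans (push-idem x r) (push-top r)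
  push-push {t} x one | no t≢x rewrite push-≢ [] (≢-sym t≢x) | push-≢ [ t ] t≢x = backtrack-≡ t x []
  push-push {t} x (two {y = y}) | no t≢x rewrite push-≢ [ y ] (≢-sym t≢x) with x ≟ y
  ... | yes refl = push-≢ [] t≢x
  ... | no _     = trans (push-≢ (t ∷ y ∷ []) t≢x) (backtrack-≡ t x [ y ])
  push-push {t} x (more {y = y} {z} {s} t≢z r) | no t≢x rewrite push-≢ (y ∷ z ∷ s) (≢-sym t≢x) with x ≟ y
  ... | no _     = trans (push-≢ (t ∷ y ∷ z ∷ s) t≢x) (backtrack-≡ t x (y ∷ z ∷ s))
  ... | yes refl rewrite push-≢ (z ∷ s) t≢x with t ≟ z
  ...   | yes t≡z = contradiction t≡z t≢z
  ...   | no _    = refl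

  degenerate⇒≡ : ∀ {x y z} → Degenerate x y z → x ≡ y ⊎ x ≡ z ⊎ y ≡ z
  degenerate⇒≡ {x} {y} {z} d with x ≟ y | x ≟ z | y ≟ z
  ... | yes x≡y | _       | _       = inj₁ x≡y
  ... | no _    | yes x≡z | _       = inj₂ (inj₁ x≡z)
  ... | no _    | no _    | yes y≡z = inj₂ (inj₂ y≡z)
  ... | no x≢y  | no x≢z  | no y≢z  =
    contradiction ((x≢y ∷ x≢z ∷ []) ∷ (y≢z ∷ []) ∷ [] ∷ []) d

  flat-triple : ∀ {a b c} → Degenerate a b c → Flat (_∈ a ∷ b ∷ c ∷ [])
  flat-triple {a} {b} {c} d with degenerate⇒≡ d
  ... | inj₁ refl = flat-⊆ drop (flat-pair a c)
    where
    drop : ∀ {x} → x ∈ a ∷ a ∷ c ∷ [] → x ∈ a ∷ c ∷ []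
    drop (here eq)  = here eq
    drop (there x∈) = x∈
  ... | inj₂ (inj₁ refl) = flat-⊆ drop (flat-pair a b)
    where
    drop : ∀ {x} → x ∈ a ∷ b ∷ a ∷ [] → x ∈ a ∷ b ∷ []
    drop (here eq)                 = here eq
    drop (there (here eq))         = there (here eq)
    drop (there (there (here eq))) = here eq
  ... | inj₂ (inj₂ refl) = flat-⊆ drop (flat-pair a b)
    where
    drop : ∀ {x} → x ∈ a ∷ b ∷ b ∷ [] → x ∈ a ∷ b ∷ []
    drop (here eq)                 = here eq
    drop (there (here eq))         = there (here eq)
    drop (there (there (here eq))) = there (here eq)

  -- Degenerate triangles can be filled in: one of the steps from `t` to `x` and from `x` to `y` is
  -- idle, or the second undoes the first.
  push-degenerate : ∀ {t s x y} → Reduced t s → Degenerate t x y →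
                    push y (push x s) ≡ push y s
  push-degenerate {x = x} {y} r d with degenerate⇒≡ d
  ... | inj₁ refl        = cong (push y) (push-top r)
  ... | inj₂ (inj₁ refl) = trans (push-push x r) (sym (push-top r))
  ... | inj₂ (inj₂ refl) = push-idem x r

  pushes : List C → List C → List C
  pushes = foldl (λ s x → push x s)

  -- The letter `x` moves cyclically from the front of the word to its end. If it repeats the last
  -- letter `t`, one copy is deleted. If it backtracks, `t` lies cyclically between two equal
  -- letters; `t` is deleted and then one of the two. Otherwise the move is a mere rotation.
  contractible-push : ∀ {t s} x w → Reduced t s →
    Contractible (w ++ reverse (push x s)) → Contractible (x ∷ w ++ reverse s)
  contractible-push {s = t ∷ s} x w r p rewrite unfold-reverse t s with x ≟ t
  ... | yes refl rewrite unfold-reverse t s | sym (++-assoc w (reverse s) [ t ]) =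
    contractible-⟶ (contract-repetition (w ++ reverse s) ∼-refl) p
  contractible-push {s = t ∷ []} x w r p | no _
    rewrite unfold-reverse t [] | sym (++-assoc w [ t ] [ x ]) =
    contractible-rotate x (w ∷ʳ t) p
  contractible-push {s = t ∷ y ∷ s} x w r p | no _ with x ≟ y
  ... | yes refl rewrite unfold-reverse x s | sym (++-assoc w (reverse s ∷ʳ x) [ t ])
                       | sym (++-assoc w (reverse s) [ x ]) =
    contractible-⟶ (contract-backtrack (w ++ reverse s) (rotation (x ∷ (w ++ reverse s) ∷ʳ x) [ t ]))
      (contractible-⟶ (contract-repetition (w ++ reverse s) ∼-refl) p)
  ... | no _ rewrite unfold-reverse x (t ∷ y ∷ s) | unfold-reverse t (y ∷ s)
                   | sym (++-assoc w (reverse (y ∷ s) ∷ʳ t) [ x ]) =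
    contractible-rotate x (w ++ reverse (y ∷ s) ∷ʳ t) p

  contractible-pushes : ∀ {t s} w → Reduced t s →
    Contractible (reverse (pushes s w)) → Contractible (w ++ reverse s)
  contractible-pushes []      r p = p
  contractible-pushes (x ∷ w) r p =
    contractible-push x w r (contractible-pushes w (push-reduced x r) p)

  pushes-reduced : ∀ {t s} w → Reduced t s → ∃ λ x → Reduced x (pushes s w)
  pushes-reduced []      r = _ , r
  pushes-reduced (x ∷ w) r = pushes-reduced w (push-reduced x r)

  -- One push shortens a walk by at most one letter, so `s` has at most two. A cyclic word of two
  -- letters contracts because both neighbours of a letter coincide.
  contractible-reduced : ∀ {t s} x → Reduced t s → push x s ≡ x ∷ [] → Contractible (reverse s)
  contractible-reduced x (one {t}) _ = t , ε
  contractible-reduced {t} x two eq with x ≟ t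
  contractible-reduced {t} x (two {y = y}) () | yes _
  contractible-reduced {t} x (two {y = y}) eq | no _ =
    t , contract ∼-refl degenerate-xyx ◅ ε
  contractible-reduced {t} x (more {y = y} _ _) eq with x ≟ t
  contractible-reduced {t} x (more {y = y} _ _) () | yes _
  ... | no _ with x ≟ y
  contractible-reduced {t} x (more {y = y} _ _) () | no _ | yes _
  contractible-reduced {t} x (more {y = y} _ _) () | no _ | no _

  -- The closed walk visits `x` at both ends, while the cyclic word contains this letter once. The
  -- last push is therefore split off and left to `contractible-reduced`.
  contractible-closed : ∀ x w → pushes (x ∷ []) (w ∷ʳ x) ≡ x ∷ [] → Contractible (x ∷ w)
  contractible-closed x w eq = contractible-rotate x w (contractible-pushes w one
    (contractible-reduced x (proj₂ (pushes-reduced w one))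
      (trans (sym (foldl-∷ʳ (λ s x → push x s) (x ∷ []) x w)) eq)))

  module _ {i r} {I : Set i} {_R_ : Rel I r} where

    -- The letter at the first point of the chain is left out, since `s` is meant to end there.
    pushAlong : (I → C) → ∀ {a b} → Star _R_ a b → List C → List C
    pushAlong u ε            s = s
    pushAlong u (_◅_ {j = b} _ p) s = pushAlong u p (push (u b) s)

    pushAlong-reduced : ∀ (u : I → C) {a b} (p : Star _R_ a b) {s} →
                        Reduced (u a) s → Reduced (u b) (pushAlong u p s)
    pushAlong-reduced u ε       r = r
    pushAlong-reduced u (_ ◅ p) r = pushAlong-reduced u p (push-reduced _ r)

    -- The labels `u` and `v` are the rails of a ladder. The diagonal from `u a` to `v b` cuts each
    -- square into two degenerate triangles, and filling both moves the rung from `a` to `b`.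
    pushAlong-homotopy : ∀ {u v : I → C} →
      (∀ {a b} → a R b → Degenerate (u a) (v a) (v b) × Degenerate (u a) (u b) (v b)) →
      ∀ {a b} (p : Star _R_ a b) {s} → Reduced (u a) s →
      push (v b) (pushAlong u p s) ≡ pushAlong v p (push (v a) s)
    pushAlong-homotopy d ε       r = refl
    pushAlong-homotopy {u} {v} d (_◅_ {i = a} {j = b} aRb p) {s} r = trans
      (pushAlong-homotopy d p (push-reduced (u b) r))
      (cong (pushAlong v p)
        (trans (push-degenerate r (proj₂ (d aRb))) (sym (push-degenerate r (proj₁ (d aRb))))))

    pushAlong-constant : ∀ {u : I → C} {x} → (∀ a → u a ≡ x) →
      ∀ {a b} (p : Star _R_ a b) {s} → Reduced x s → pushAlong u p s ≡ s
    pushAlong-constant const ε       r = refl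
    pushAlong-constant {u} const (_◅_ {j = b} _ p) {s} r
      rewrite const b | push-top r = pushAlong-constant const p r

-- A ring solver with integer coefficients.

module IntegerSolver {r ℓ} (R : CommutativeRing r ℓ) where
  open CommutativeRing R
  open Algebra.Properties.Ring ring using (-‿distribˡ-*; -‿distribʳ-*; -‿involutive)
  open Algebra.Properties.AbelianGroup +-abelianGroup using (⁻¹-∙-comm)
  open Algebra.Properties.Semiring.Mult.TCOptimised semiring
    using (×-homo-+; ×1-homo-*) renaming (_×_ to _·_)
  open Algebra.Solver.Ring.NaturalCoefficients.Default commutativeSemiring
  open Relation.Binary.Reasoning.Setoid setoid

  -- The coefficient (m , n) stands for the integer m − n; the first clause
  -- makes the coefficients (0 , 0) and (1 , 0) denote 0# and 1# on the nose.
  -- Results of arithmetic are reduced, so that equal integers are identical.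

  ⟦_⟧ᶜ : ℕ × ℕ → Carrier
  ⟦ m , ℕ.zero ⟧ᶜ      = m · 1#
  ⟦ m , n@(ℕ.suc _) ⟧ᶜ = m · 1# - n · 1#

  reduce : ℕ → ℕ → ℕ × ℕ
  reduce (ℕ.suc m) (ℕ.suc n) = reduce m n
  reduce m         n         = m , n

  coefficients : RawRing _ _
  coefficients = record
    { Carrier = ℕ × ℕ
    ; _≈_     = _≡_
    ; _+_     = λ (m , n) (m′ , n′) → reduce (m ℕ.+ m′) (n ℕ.+ n′)
    ; _*_     = λ (m , n) (m′ , n′) → reduce (m ℕ.* m′ ℕ.+ n ℕ.* n′) (m ℕ.* n′ ℕ.+ n ℕ.* m′)
    ; -_      = λ (m , n) → n , m
    ; 0#      = 0 , 0
    ; 1#      = 1 , 0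
    }

  module Coeff = RawRing coefficients

  -‿0# : - 0# ≈ 0#
  -‿0# = trans (sym (+-identityˡ (- 0#))) (-‿inverseʳ 0#)

  difference : ∀ m n → ⟦ m , n ⟧ᶜ ≈ m · 1# - n · 1#
  difference m ℕ.zero    = sym (trans (+-congˡ -‿0#) (+-identityʳ _))
  difference m (ℕ.suc n) = refl

  cancel : ∀ x y z → (x + z) - (y + z) ≈ x - y
  cancel x y z = begin
    (x + z) - (y + z)         ≈⟨ +-congˡ (⁻¹-∙-comm y z) ⟨
    (x + z) + (- y + - z)     ≈⟨ solve 4 (λ x y z z′ → (x :+ z) :+ (y :+ z′) := (z :+ z′) :+ (x :+ y)) refl x (- y) z (- z) ⟩
    (z - z) + (x - y)         ≈⟨ +-congʳ (-‿inverseʳ z) ⟩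
    0# + (x - y)              ≈⟨ +-identityˡ _ ⟩
    x - y                     ∎

  suc-· : ∀ m → ℕ.suc m · 1# ≈ m · 1# + 1#
  suc-· m = trans (×-homo-+ 1# 1 m) (+-comm _ _)

  difference-reduce : ∀ m n → ⟦ reduce m n ⟧ᶜ ≈ m · 1# - n · 1#
  difference-reduce (ℕ.suc m) (ℕ.suc n) = begin
    ⟦ reduce m n ⟧ᶜ                   ≈⟨ difference-reduce m n ⟩
    m · 1# - n · 1#                   ≈⟨ cancel _ _ 1# ⟨
    (m · 1# + 1#) - (n · 1# + 1#)     ≈⟨ +-cong (suc-· m) (-‿cong (suc-· n)) ⟨
    ℕ.suc m · 1# - ℕ.suc n · 1#       ∎
  difference-reduce ℕ.zero    n         = difference ℕ.zero n
  difference-reduce (ℕ.suc m) ℕ.zero    = difference (ℕ.suc m) ℕ.zero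

  ⟦⟧-+ : ∀ x y → ⟦ x Coeff.+ y ⟧ᶜ ≈ ⟦ x ⟧ᶜ + ⟦ y ⟧ᶜ
  ⟦⟧-+ (m , n) (m′ , n′) = begin
    ⟦ reduce (m ℕ.+ m′) (n ℕ.+ n′) ⟧ᶜ               ≈⟨ difference-reduce (m ℕ.+ m′) (n ℕ.+ n′) ⟩
    (m ℕ.+ m′) · 1# - (n ℕ.+ n′) · 1#               ≈⟨ +-cong (×-homo-+ 1# m m′) (-‿cong (×-homo-+ 1# n n′)) ⟩
    (m · 1# + m′ · 1#) - (n · 1# + n′ · 1#)         ≈⟨ +-congˡ (⁻¹-∙-comm _ _) ⟨
    (m · 1# + m′ · 1#) + (- (n · 1#) + - (n′ · 1#)) ≈⟨ solve 4 (λ a b c d → (a :+ b) :+ (c :+ d) := (a :+ c) :+ (b :+ d)) refl _ _ _ _ ⟩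
    (m · 1# - n · 1#) + (m′ · 1# - n′ · 1#)         ≈⟨ +-cong (difference m n) (difference m′ n′) ⟨
    ⟦ m , n ⟧ᶜ + ⟦ m′ , n′ ⟧ᶜ                       ∎

  ⟦⟧-* : ∀ x y → ⟦ x Coeff.* y ⟧ᶜ ≈ ⟦ x ⟧ᶜ * ⟦ y ⟧ᶜ
  ⟦⟧-* (m , n) (m′ , n′) = begin
    ⟦ reduce (m ℕ.* m′ ℕ.+ n ℕ.* n′) (m ℕ.* n′ ℕ.+ n ℕ.* m′) ⟧ᶜ
      ≈⟨ difference-reduce (m ℕ.* m′ ℕ.+ n ℕ.* n′) (m ℕ.* n′ ℕ.+ n ℕ.* m′) ⟩
    (m ℕ.* m′ ℕ.+ n ℕ.* n′) · 1# - (m ℕ.* n′ ℕ.+ n ℕ.* m′) · 1#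
      ≈⟨ +-cong (products m m′ n n′) (-‿cong (products m n′ n m′)) ⟩
    (a * a′ + b * b′) - (a * b′ + b * a′)
      ≈⟨ +-cong (+-congˡ minusMinus) (trans (sym (⁻¹-∙-comm _ _)) (+-cong (-‿distribʳ-* a b′) (-‿distribˡ-* b a′))) ⟩
    (a * a′ + - b * - b′) + (a * - b′ + - b * a′)
      ≈⟨ solve 4 (λ a b a′ b′ → (a :* a′ :+ b :* b′) :+ (a :* b′ :+ b :* a′) := (a :+ b) :* (a′ :+ b′)) refl a (- b) a′ (- b′) ⟩
    (a - b) * (a′ - b′)
      ≈⟨ *-cong (difference m n) (difference m′ n′) ⟨
    ⟦ m , n ⟧ᶜ * ⟦ m′ , n′ ⟧ᶜ ∎
    where
    a  = m · 1#
    b  = n · 1#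
    a′ = m′ · 1#
    b′ = n′ · 1#
    products : ∀ i j k l → (i ℕ.* j ℕ.+ k ℕ.* l) · 1# ≈ (i · 1#) * (j · 1#) + (k · 1#) * (l · 1#)
    products i j k l = trans (×-homo-+ 1# (i ℕ.* j) (k ℕ.* l)) (+-cong (×1-homo-* i j) (×1-homo-* k l))
    minusMinus : b * b′ ≈ - b * - b′
    minusMinus = begin
      b * b′         ≈⟨ -‿involutive _ ⟨
      - (- (b * b′)) ≈⟨ -‿cong (-‿distribʳ-* b b′) ⟩
      - (b * - b′)   ≈⟨ -‿distribˡ-* b (- b′) ⟩
      - b * - b′     ∎

  ⟦⟧-neg : ∀ x → ⟦ Coeff.- x ⟧ᶜ ≈ - ⟦ x ⟧ᶜ
  ⟦⟧-neg (m , n) = begin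
    ⟦ n , m ⟧ᶜ                ≈⟨ difference n m ⟩
    n · 1# - m · 1#           ≈⟨ +-comm _ _ ⟩
    - (m · 1#) + n · 1#       ≈⟨ +-congˡ (-‿involutive _) ⟨
    - (m · 1#) - - (n · 1#)   ≈⟨ ⁻¹-∙-comm _ _ ⟩
    - (m · 1# - n · 1#)       ≈⟨ -‿cong (difference m n) ⟨
    - ⟦ m , n ⟧ᶜ              ∎

  homomorphism : coefficients -Raw-AlmostCommutative⟶ fromCommutativeRing R
  homomorphism = record
    { ⟦_⟧    = ⟦_⟧ᶜ
    ; +-homo = ⟦⟧-+
    ; *-homo = ⟦⟧-*
    ; -‿homo = ⟦⟧-neg
    ; 0-homo = refl
    ; 1-homo = refl
    }

  coeff≟ : ∀ x y → Maybe (⟦ x ⟧ᶜ ≈ ⟦ y ⟧ᶜ)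
  coeff≟ (m , n) (m′ , n′) with m ℕ.≟ m′ | n ℕ.≟ n′
  ... | yes ≡.refl | yes ≡.refl = just refl
  ... | _          | _          = nothing

  module Solver = Algebra.Solver.Ring coefficients (fromCommutativeRing R) homomorphism coeff≟

-- Order, closeness and absolute bounds in the field.

module OrderedField (em : ∀ {ℓ} → ExcludedMiddle ℓ) (ℝ : CompleteOrderedField) where
  open CompleteOrderedField ℝ
  open IsTotalOrder isTotalOrder using (antisym; total; ≤-respˡ-≈; ≤-respʳ-≈)
    renaming (reflexive to ≤-reflexive; refl to ≤-refl; trans to ≤-trans)
  open IntegerSolver commutativeRing using (module Solver)
  open Solver

  -- Order facts x ≤ y are combined as 0# ≤ y - x, the combination being
  -- checked by the ring solver.

  by-≤ : ∀ {x y w} → 0# ≤ w → w ≈ y - x → x ≤ y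
  by-≤ {x} {y} 0≤w w≈ =
    ≤-respˡ-≈ (+-identityˡ x) (≤-respʳ-≈ (trans (+-congʳ w≈) (solve 2 (λ x y → (y :- x) :+ x := y) refl x y))
      (+-monoˡ-≤ x 0≤w))

  by-< : ∀ {x y w} → 0# < w → w ≈ y - x → x < y
  by-< {x} {y} {w} (0≤w , 0≉w) w≈ = by-≤ 0≤w w≈ , λ x≈y → 0≉w (begin
    0#    ≈⟨ -‿inverseʳ x ⟨
    x - x ≈⟨ +-congʳ x≈y ⟩
    y - x ≈⟨ w≈ ⟨
    w     ∎)
    where open Relation.Binary.Reasoning.Setoid setoid

  gap-≤ : ∀ {x y} → x ≤ y → 0# ≤ y - x
  gap-≤ {x} x≤y = ≤-respˡ-≈ (-‿inverseʳ x) (+-monoˡ-≤ (- x) x≤y)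

  gap-< : ∀ {x y} → x < y → 0# < y - x
  gap-< {x} {y} (x≤y , x≉y) = gap-≤ x≤y , λ 0≈ → x≉y (begin
    x            ≈⟨ +-identityˡ x ⟨
    0# + x       ≈⟨ +-congʳ 0≈ ⟩
    (y - x) + x  ≈⟨ solve 2 (λ x y → (y :- x) :+ x := y) refl x y ⟩
    y            ∎)
    where open Relation.Binary.Reasoning.Setoid setoid

  <⇒≤ : ∀ {x y} → x < y → x ≤ y
  <⇒≤ = proj₁

  <⇒≱ : ∀ {x y} → x < y → ¬ y ≤ x
  <⇒≱ (x≤y , x≉y) y≤x = x≉y (antisym x≤y y≤x)

  ≰⇒> : ∀ {x y} → ¬ x ≤ y → y < x
  ≰⇒> {x} {y} x≰y with total x y
  ... | inj₁ x≤y = contradiction x≤y x≰y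
  ... | inj₂ y≤x = y≤x , λ y≈x → x≰y (≤-reflexive (sym y≈x))

  ≮⇒≥ : ∀ {x y} → ¬ x < y → y ≤ x
  ≮⇒≥ {x} {y} x≮y with em {P = y ≤ x}
  ... | yes y≤x = y≤x
  ... | no y≰x  = contradiction (≰⇒> y≰x) x≮y

  +-nonNeg : ∀ {x y} → 0# ≤ x → 0# ≤ y → 0# ≤ x + y
  +-nonNeg {x} {y} 0≤x 0≤y = ≤-trans 0≤y (≤-respˡ-≈ (+-identityˡ y) (+-monoˡ-≤ y 0≤x))

  +-pos : ∀ {x y} → 0# < x → 0# ≤ y → 0# < x + y
  +-pos {x} {y} 0<x 0≤y = ≰⇒> λ x+y≤0 → <⇒≱ 0<x
    (≤-trans (by-≤ 0≤y (solve 2 (λ x y → y := (x :+ y) :- x) refl x y)) x+y≤0)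

  <-≤-trans : ∀ {x y z} → x < y → y ≤ z → x < z
  <-≤-trans {x} {y} {z} x<y y≤z =
    by-< (+-pos (gap-< x<y) (gap-≤ y≤z)) (solve 3 (λ x y z → (y :- x) :+ (z :- y) := z :- x) refl x y z)

  ≤-<-trans : ∀ {x y z} → x ≤ y → y < z → x < z
  ≤-<-trans {x} {y} {z} x≤y y<z =
    by-< (+-pos (gap-< y<z) (gap-≤ x≤y)) (solve 3 (λ x y z → (z :- y) :+ (y :- x) := z :- x) refl x y z)

  <-respˡ-≈ : ∀ {x y z} → x ≈ y → x < z → y < z
  <-respˡ-≈ x≈y = ≤-<-trans (≤-reflexive (sym x≈y))

  square-nonNeg : ∀ x → 0# ≤ x * x
  square-nonNeg x with total 0# x
  ... | inj₁ 0≤x = *-nonNeg 0≤x 0≤x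
  ... | inj₂ x≤0 = ≤-respʳ-≈ (solve 1 (λ x → (con (0 , 0) :- x) :* (con (0 , 0) :- x) := x :* x) refl x)
                     (*-nonNeg (gap-≤ x≤0) (gap-≤ x≤0))

  0<1 : 0# < 1#
  0<1 = ≤-respʳ-≈ (*-identityʳ 1#) (square-nonNeg 1#) , 0≉1

  0≤1 : 0# ≤ 1#
  0≤1 = <⇒≤ 0<1

  2# : Carrier
  2# = 1# + 1#

  abstract
    reciprocal-2 : ∃ λ h → 2# * h ≈ 1#
    reciprocal-2 = inverse 2# λ 2≈0 → proj₂ (+-pos 0<1 0≤1) (sym 2≈0)

  ½ : Carrier
  ½ = proj₁ reciprocal-2

  half : Carrier → Carrier
  half x = x * ½

  half+half : ∀ x → half x + half x ≈ x
  half+half x = begin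
    x * ½ + x * ½ ≈⟨ solve 2 (λ x h → x :* h :+ x :* h := x :* (con (2 , 0) :* h)) refl x ½ ⟩
    x * (2# * ½)  ≈⟨ *-congˡ (proj₂ reciprocal-2) ⟩
    x * 1#        ≈⟨ *-identityʳ x ⟩
    x             ∎
    where open Relation.Binary.Reasoning.Setoid setoid

  half-pos : ∀ {x} → 0# < x → 0# < half x
  half-pos {x} 0<x = ≰⇒> λ h≤0 → <⇒≱ 0<x
    (by-≤ (+-nonNeg (gap-≤ h≤0) (gap-≤ h≤0))
      (trans (solve 1 (λ h → (con (0 , 0) :- h) :+ (con (0 , 0) :- h) := con (0 , 0) :- (h :+ h)) refl (half x))
        (+-congˡ (-‿cong (half+half x)))))

  half-< : ∀ {x} → 0# < x → half x < x
  half-< {x} 0<x = by-< (half-pos 0<x)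
    (trans (solve 1 (λ h → h := (h :+ h) :- h) refl (half x)) (+-congʳ (half+half x)))

  common-bound : ∀ {x y} → 0# < x → 0# < y → ∃ λ z → 0# < z × z ≤ x × z ≤ y
  common-bound {x} {y} 0<x 0<y with total x y
  ... | inj₁ x≤y = x , 0<x , ≤-refl , x≤y
  ... | inj₂ y≤x = y , 0<y , y≤x , ≤-refl

  Close : Carrier → Carrier → Carrier → Set
  Close δ x y = (x - y < δ) × (y - x < δ)

  close-sym : ∀ {δ x y} → Close δ x y → Close δ y x
  close-sym (x-y<δ , y-x<δ) = y-x<δ , x-y<δ

  close-≈ : ∀ {δ x y} → 0# < δ → x ≈ y → Close δ x y
  close-≈ {δ} {x} {y} 0<δ x≈y = one x≈y , one (sym x≈y)
    where
    one : ∀ {x y} → x ≈ y → x - y < δ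
    one {x} {y} x≈y = <-respˡ-≈ (trans (sym (-‿inverseʳ y)) (+-congʳ (sym x≈y))) 0<δ

  close-trans : ∀ {δ δ′ η x y z} → δ + δ′ ≤ η → Close δ x y → Close δ′ y z → Close η x z
  close-trans {δ} {δ′} {η} δ+δ′≤η (x-y<δ , y-x<δ) (y-z<δ′ , z-y<δ′) =
    one x-y<δ y-z<δ′ δ+δ′≤η , one z-y<δ′ y-x<δ (≤-respˡ-≈ (+-comm δ δ′) δ+δ′≤η)
    where
    one : ∀ {δ δ′ x y z} → x - y < δ → y - z < δ′ → δ + δ′ ≤ η → x - z < η
    one {δ} {δ′} {x} {y} {z} p q r = by-<
      (+-pos (gap-< p) (+-nonNeg (<⇒≤ (gap-< q)) (gap-≤ r)))
      (solve 6 (λ x y z δ δ′ η →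
          (δ :- (x :- y)) :+ ((δ′ :- (y :- z)) :+ (η :- (δ :+ δ′))) := η :- (x :- z))
        refl x y z δ δ′ η)

  close-respʳ : ∀ {δ x y z} → y ≈ z → Close δ x y → Close δ x z
  close-respʳ {δ} {x} {y} {z} y≈z (p , q) =
    <-respˡ-≈ {x - y} {x - z} (+-congˡ (-‿cong y≈z)) p , <-respˡ-≈ {y - x} {z - x} (+-congʳ y≈z) q

  close-respˡ : ∀ {δ x y z} → x ≈ z → Close δ x y → Close δ z y
  close-respˡ x≈z close = close-sym (close-respʳ x≈z (close-sym close))

  close-≤ : ∀ {δ η x y} → δ ≤ η → Close δ x y → Close η x y
  close-≤ δ≤η (p , q) = <-≤-trans p δ≤η , <-≤-trans q δ≤η

  close⇒pos : ∀ {δ x y} → δ ≤ y → Close δ x y → 0# < x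
  close⇒pos {δ} {x} {y} δ≤y (_ , y-x<δ) = by-< (+-pos (gap-< y-x<δ) (gap-≤ δ≤y))
    (solve 3 (λ d x y → (d :- (y :- x)) :+ (y :- d) := x :- con (0 , 0)) refl δ x y)

  ∣_∣≤_ : Carrier → Carrier → Set
  ∣ x ∣≤ b = (x ≤ b) × (- x ≤ b)

  close⇒∣∣≤ : ∀ {δ x y} → Close δ x y → ∣ x - y ∣≤ δ
  close⇒∣∣≤ {δ} {x} {y} (p , q) = <⇒≤ p ,
    ≤-respˡ-≈ (solve 2 (λ x y → y :- x := :- (x :- y)) refl x y) (<⇒≤ q)

  -- Twice `a b - x y` is (a - x)(b + y) + (a + x)(b - y), and twice `a b + x y` is (a - x)(b - y) +
  -- (a + x)(b + y). All these factors are nonnegative, so the signs of `x` and `y` need not be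
  -- distinguished.
  ∣*∣≤ : ∀ {x y a b} → ∣ x ∣≤ a → ∣ y ∣≤ b → ∣ x * y ∣≤ (a * b)
  ∣*∣≤ {x} {y} {a} {b} (x≤a , -x≤a) (y≤b , -y≤b) =
    halve (+-nonNeg (*-nonNeg (gap-≤ x≤a) (gap-≤ -y≤b)) (*-nonNeg (gap-≤ -x≤a) (gap-≤ y≤b)))
      (solve 4 (λ x y a b → (a :- x) :* (b :- :- y) :+ (a :- :- x) :* (b :- y)
        := (a :* b :- x :* y) :+ (a :* b :- x :* y)) refl x y a b) ,
    halve (+-nonNeg (*-nonNeg (gap-≤ x≤a) (gap-≤ y≤b)) (*-nonNeg (gap-≤ -x≤a) (gap-≤ -y≤b)))
      (solve 4 (λ x y a b → (a :- x) :* (b :- y) :+ (a :- :- x) :* (b :- :- y)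
        := (a :* b :- :- (x :* y)) :+ (a :* b :- :- (x :* y))) refl x y a b)
    where
    halve : ∀ {u v w} → 0# ≤ w → w ≈ (v - u) + (v - u) → u ≤ v
    halve {u} {v} 0≤w w≈ = ≮⇒≥ λ v<u → <⇒≱
      (+-pos (gap-< v<u) (<⇒≤ (gap-< v<u)))
      (by-≤ 0≤w (trans w≈ (solve 2 (λ u v → (v :- u) :+ (v :- u) := con (0 , 0) :- ((u :- v) :+ (u :- v))) refl u v)))

  ∣∣≤⇒close : ∀ {x y z b δ} → ∣ z ∣≤ b → b < δ → z ≈ x - y → Close δ x y
  ∣∣≤⇒close {x} {y} {z} (z≤b , -z≤b) b<δ z≈ =
    ≤-<-trans (≤-respˡ-≈ z≈ z≤b) b<δ ,
    ≤-<-trans (≤-respˡ-≈ (trans (-‿cong z≈) (solve 2 (λ x y → :- (x :- y) := y :- x) refl x y)) -z≤b) b<δ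

  ∣+∣≤ : ∀ {x y a b} → ∣ x ∣≤ a → ∣ y ∣≤ b → ∣ x + y ∣≤ (a + b)
  ∣+∣≤ {x} {y} {a} {b} (x≤a , -x≤a) (y≤b , -y≤b) =
    by-≤ (+-nonNeg (gap-≤ x≤a) (gap-≤ y≤b))
      (solve 4 (λ x y a b → (a :- x) :+ (b :- y) := (a :+ b) :- (x :+ y)) refl x y a b) ,
    by-≤ (+-nonNeg (gap-≤ -x≤a) (gap-≤ -y≤b))
      (solve 4 (λ x y a b → (a :- :- x) :+ (b :- :- y) := (a :+ b) :- :- (x :+ y)) refl x y a b)

  ∣-∣≤ : ∀ {x y a b} → ∣ x ∣≤ a → ∣ y ∣≤ b → ∣ x - y ∣≤ (a + b)
  ∣-∣≤ {y = y} x≤ (y≤b , -y≤b) = ∣+∣≤ x≤ (-y≤b , ≤-respˡ-≈ (solve 1 (λ y → y := :- :- y) refl y) y≤b)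

  -- If x exceeded 1, then x² - 1 = 2 (x - 1) + (x - 1)² would be positive.
  square≤1⇒∣∣≤1 : ∀ {x} → x * x ≤ 1# → ∣ x ∣≤ 1#
  square≤1⇒∣∣≤1 {x} x²≤1 = one x²≤1 , one (≤-respˡ-≈ (solve 1 (λ x → x :* x := (:- x) :* (:- x)) refl x) x²≤1)
    where
    one : ∀ {x} → x * x ≤ 1# → x ≤ 1#
    one {x} x²≤1 = ≮⇒≥ λ 1<x → <⇒≱
      (by-< (+-pos (gap-< 1<x) (+-nonNeg (<⇒≤ (gap-< 1<x)) (square-nonNeg (x - 1#))))
        (solve 1 (λ x → let u = con (1 , 0) in (x :- u) :+ ((x :- u) :+ (x :- u) :* (x :- u)) := x :* x :- u) refl x))
      x²≤1

  close-arbitrarily⇒≈ : ∀ {x y} → (∀ δ → 0# < δ → Close δ x y) → x ≈ y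
  close-arbitrarily⇒≈ close = antisym (one (λ δ 0<δ → proj₁ (close δ 0<δ))) (one (λ δ 0<δ → proj₂ (close δ 0<δ)))
    where
    one : ∀ {x y} → (∀ δ → 0# < δ → x - y < δ) → x ≤ y
    one {x} {y} small = ≮⇒≥ λ y<x → <⇒≱ (small (x - y) (gap-< y<x)) ≤-refl

  -- Compactness of the unit interval.

  InUnit : Carrier → Set
  InUnit x = (0# ≤ x) × (x ≤ 1#)

  0∈ : InUnit 0#
  0∈ = ≤-refl , 0≤1

  1∈ : InUnit 1#
  1∈ = 0≤1 , ≤-refl

  -- Cousin's lemma. Let `s` be the supremum of the points reachable from 0. A reachable point less
  -- than `δ` below `s` can be joined across `s` to `s + half δ`, or to 1 if that comes first; the
  -- former contradicts the choice of `s`. Half of `δ` is taken because closeness is strict.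
  cousin : ∀ {ℓ} (Φ : Carrier → Carrier → Set ℓ) →
    (∀ {a b c} → a ≤ b → b ≤ c → Φ a b → Φ b c → Φ a c) →
    (∀ x → InUnit x → ∃ λ δ → 0# < δ ×
      (∀ a b → InUnit a → InUnit b → a ≤ x → x ≤ b → Close δ a x → Close δ x b → Φ a b)) →
    Φ 0# 1#
  cousin Φ additive local = conclude (supremum Reachable (0# , 0-reachable) (1# , λ _ r → proj₂ (proj₁ r)))
    where
    -- Excluded middle lowers Φ to the universe in which suprema exist.
    Reachable : Carrier → Set
    Reachable x = InUnit x × True (em {P = Φ 0# x})

    0-reachable : Reachable 0#
    0-reachable = 0∈ , fromWitness (let δ , 0<δ , near = local 0# 0∈ in
      near 0# 0# 0∈ 0∈ ≤-refl ≤-refl (close-≈ 0<δ refl) (close-≈ 0<δ refl))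

    module _ {s δ} (upper : UpperBound Reachable s) (s∈ : InUnit s) (0<δ : 0# < δ)
             (near : ∀ a b → InUnit a → InUnit b → a ≤ s → s ≤ b → Close δ a s → Close δ s b → Φ a b)
             where

      reach : ∀ {a} b → Reachable a → s - a < δ → InUnit b → s ≤ b → b ≤ s + half δ → Φ 0# b
      reach {a} b r@(a∈ , Φ0a) s-a<δ b∈ s≤b b≤s+ =
        additive (proj₁ a∈) a≤b (toWitness Φ0a) (near a b a∈ b∈ a≤s s≤b a-close b-close)
        where
        a≤s : a ≤ s
        a≤s = upper a r
        a≤b : a ≤ b
        a≤b = ≤-trans a≤s s≤b
        a-close : Close δ a s
        a-close = ≤-<-trans (by-≤ (gap-≤ a≤s) (solve 2 (λ s a → s :- a := con (0 , 0) :- (a :- s)) refl s a)) 0<δ , s-a<δ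
        b-close : Close δ s b
        b-close =
          ≤-<-trans (by-≤ (gap-≤ s≤b) (solve 2 (λ s b → b :- s := con (0 , 0) :- (s :- b)) refl s b)) 0<δ ,
          ≤-<-trans (by-≤ (gap-≤ b≤s+) (solve 3 (λ s b h → (s :+ h) :- b := h :- (b :- s)) refl s b (half δ))) (half-< 0<δ)

      advance : ∀ {a} → Reachable a → s - a < δ → 1# ≤ s + half δ ⊎ s + half δ ≤ 1# → Φ 0# 1#
      advance r s-a<δ (inj₁ 1≤) = reach 1# r s-a<δ 1∈ (proj₂ s∈) 1≤
      advance r s-a<δ (inj₂ ≤1) = contradiction
        (upper (s + half δ) (b∈ , fromWitness (reach (s + half δ) r s-a<δ b∈ (<⇒≤ s<b) ≤-refl))) (<⇒≱ s<b)
        where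
        s<b : s < s + half δ
        s<b = by-< (half-pos 0<δ) (solve 2 (λ s h → h := (s :+ h) :- s) refl s (half δ))
        b∈ : InUnit (s + half δ)
        b∈ = ≤-trans (proj₁ s∈) (<⇒≤ s<b) , ≤1

    -- If there were no such point, `s - δ` would be a smaller upper bound.
    approximate : ∀ {s δ} → (∀ u → UpperBound Reachable u → s ≤ u) → 0# < δ →
                  Dec (∃ λ a → Reachable a × s - a < δ) → ∃ λ a → Reachable a × s - a < δ
    approximate least 0<δ (yes found) = found
    approximate {s} {δ} least 0<δ (no none) = contradiction
      (least (s - δ) λ a r → by-≤ (gap-≤ (≮⇒≥ λ s-a<δ → none (a , r , s-a<δ)))
        (solve 3 (λ s a δ → (s :- a) :- δ := (s :- δ) :- a) refl s a δ))
      (<⇒≱ (by-< 0<δ (solve 2 (λ s δ → δ := s :- (s :- δ)) refl s δ)))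

    conclude : (∃ λ s → UpperBound Reachable s × (∀ u → UpperBound Reachable u → s ≤ u)) → Φ 0# 1#
    conclude (s , upper , least) =
      let s∈ : InUnit s
          s∈ = upper 0# 0-reachable , least 1# (λ _ r → proj₂ (proj₁ r))
          _ , 0<δ , near = local s s∈
          _ , r , s-a<δ = approximate least 0<δ em
      in advance upper s∈ 0<δ near r s-a<δ (total 1# _)

  -- A radius that is good at `x` is good, once halved, at all points near `x`. So one radius serves
  -- a short interval around each point, and Cousin's lemma joins these intervals.
  lebesgue-number : ∀ {ℓ} (R : Carrier → Carrier → Set ℓ) →
    (∀ {x y δ δ′} → 0# < δ′ → δ′ + δ′ ≤ δ → Close δ′ x y → R x δ → R y δ′) →
    (∀ x → InUnit x → ∃ λ δ → 0# < δ × R x δ) →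
    ∃ λ δ → 0# < δ × (∀ x → InUnit x → R x δ)
  lebesgue-number R shrink local =
    let δ , 0<δ , r = cousin Φ additive near in δ , 0<δ , λ x (0≤x , x≤1) → r x 0≤x x≤1
    where
    Φ : Carrier → Carrier → Set _
    Φ a b = ∃ λ δ → 0# < δ × (∀ x → a ≤ x → x ≤ b → R x δ)

    additive : ∀ {a b c} → a ≤ b → b ≤ c → Φ a b → Φ b c → Φ a c
    additive {a} {b} {c} _ _ (δ₁ , 0<δ₁ , r₁) (δ₂ , 0<δ₂ , r₂) with common-bound 0<δ₁ 0<δ₂
    -- The smaller radius is halved because `R` passes to smaller radii only through `shrink`.
    ... | δ , 0<δ , δ≤δ₁ , δ≤δ₂ = half δ , half-pos 0<δ , λ x a≤x x≤c → case-≤ x a≤x x≤c (total x b)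
      where
      case-≤ : ∀ x → a ≤ x → x ≤ c → x ≤ b ⊎ b ≤ x → R x (half δ)
      case-≤ x a≤x x≤c (inj₁ x≤b) = shrink (half-pos 0<δ)
        (≤-respˡ-≈ (sym (half+half δ)) δ≤δ₁) (close-≈ (half-pos 0<δ) refl) (r₁ x a≤x x≤b)
      case-≤ x a≤x x≤c (inj₂ b≤x) = shrink (half-pos 0<δ)
        (≤-respˡ-≈ (sym (half+half δ)) δ≤δ₂) (close-≈ (half-pos 0<δ) refl) (r₂ x b≤x x≤c)

    between : ∀ {δ a b x y} → a ≤ x → x ≤ b → a ≤ y → y ≤ b → Close δ a x → Close δ x b → Close δ x y
    between {δ} {a} {b} {x} {y} a≤x x≤b a≤y y≤b (_ , x-a<δ) (_ , b-x<δ) =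
      ≤-<-trans (by-≤ (gap-≤ a≤y) (solve 3 (λ a x y → y :- a := (x :- a) :- (x :- y)) refl a x y)) x-a<δ ,
      ≤-<-trans (by-≤ (gap-≤ y≤b) (solve 3 (λ b x y → b :- y := (b :- x) :- (y :- x)) refl b x y)) b-x<δ

    near : ∀ x → InUnit x → ∃ λ δ → 0# < δ ×
      (∀ a b → InUnit a → InUnit b → a ≤ x → x ≤ b → Close δ a x → Close δ x b → Φ a b)
    near x x∈ with local x x∈
    ... | δ , 0<δ , r = half δ , half-pos 0<δ , λ a b _ _ a≤x x≤b a-close b-close →
      half δ , half-pos 0<δ , λ y a≤y y≤b →
        shrink (half-pos 0<δ) (≤-reflexive (half+half δ)) (between a≤x x≤b a≤y y≤b a-close b-close) r

  UnitStep : Carrier → ∃ InUnit → ∃ InUnit → Set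
  UnitStep δ (a , _) (b , _) = Close δ a b

  -- Cousin's lemma takes the place of an Archimedean subdivision: a short interval around `x`
  -- contributes the two steps that meet at `x`.
  partition : ∀ {δ} → 0# < δ → Star (UnitStep δ) (0# , 0∈) (1# , 1∈)
  partition {δ} 0<δ = cousin (λ a b → (a∈ : InUnit a) (b∈ : InUnit b) → Star (UnitStep δ) (a , a∈) (b , b∈))
    (λ a≤b b≤c p q a∈ c∈ → p a∈ (≤-trans (proj₁ a∈) a≤b , ≤-trans b≤c (proj₂ c∈)) ◅◅ q _ c∈)
    (λ x x∈ → δ , 0<δ , λ a b _ _ _ _ ax xb a∈ b∈ → _◅_ {j = x , x∈} ax (xb ◅ ε))
    0∈ 1∈

-- Convex combinations and barycentric coordinates.

module _ (em : ∀ {ℓ} → ExcludedMiddle ℓ) (ℝ : CompleteOrderedField) where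
  open CompleteOrderedField ℝ hiding (zero)
  open IsTotalOrder isTotalOrder using ()
    renaming (reflexive to ≤-reflexive; refl to ≤-refl; trans to ≤-trans)
  open OrderedField em ℝ
  open IntegerSolver commutativeRing using (module Solver)
  open Solver
  open Topology ℝ using (Near; Disk; Simplex; ∣_∣; Homeomorphism)

  mix : ∀ {i} {I : Set i} → Carrier → (I → Carrier) → (I → Carrier) → I → Carrier
  mix s p q k = (1# - s) * p k + s * q k


  abstract
    -- (1 - s) |p|² + s |q|² - |(1 - s) p + s q|² = s (1 - s) |p - q|².
    disk-convex : ∀ {s} p q → InUnit s → Disk p → Disk q → Disk (mix s p q)
    disk-convex {s} p q (0≤s , s≤1) p∈ q∈ = by-≤
      (+-nonNeg
        (+-nonNeg (*-nonNeg (gap-≤ s≤1) (gap-≤ p∈)) (*-nonNeg 0≤s (gap-≤ q∈)))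
        (*-nonNeg (*-nonNeg 0≤s (gap-≤ s≤1))
          (+-nonNeg (square-nonNeg (p zero - q zero)) (square-nonNeg (p (suc zero) - q (suc zero))))))
      (solve 5 (λ s p₀ p₁ q₀ q₁ → let u = con (1 , 0) in
          ((u :- s) :* (u :- (p₀ :* p₀ :+ p₁ :* p₁)) :+ s :* (u :- (q₀ :* q₀ :+ q₁ :* q₁)))
            :+ (s :* (u :- s)) :* ((p₀ :- q₀) :* (p₀ :- q₀) :+ (p₁ :- q₁) :* (p₁ :- q₁))
          := u :- (((u :- s) :* p₀ :+ s :* q₀) :* ((u :- s) :* p₀ :+ s :* q₀)
                :+ ((u :- s) :* p₁ :+ s :* q₁) :* ((u :- s) :* p₁ :+ s :* q₁)))
        refl s (p zero) (p (suc zero)) (q zero) (q (suc zero)))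

  disk-bounded : ∀ p → Disk p → ∀ k → ∣ p k ∣≤ 1#
  disk-bounded p p∈ zero = square≤1⇒∣∣≤1 (≤-trans
    (by-≤ (square-nonNeg (p (suc zero))) (solve 2 (λ x y → y := (x :+ y) :- x) refl _ _)) p∈)
  disk-bounded p p∈ (suc zero) = square≤1⇒∣∣≤1 (≤-trans
    (by-≤ (square-nonNeg (p zero)) (solve 2 (λ x y → x := (x :+ y) :- y) refl _ _)) p∈)

  quarter : Carrier → Carrier
  quarter x = half (half x)

  quarter-pos : ∀ {x} → 0# < x → 0# < quarter x
  quarter-pos 0<x = half-pos (half-pos 0<x)

  quarter-< : ∀ {x} → 0# < x → quarter x < x
  quarter-< {x} 0<x = <-≤-trans {y = half x} (half-< (half-pos 0<x)) (<⇒≤ (half-< 0<x))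

  four-quarters : ∀ x → (quarter x + quarter x) + (quarter x + quarter x) ≈ x
  four-quarters x = trans (+-cong (half+half (half x)) (half+half (half x))) (half+half x)

  three-quarters : ∀ {x} → 0# < x → quarter x + (quarter x + quarter x) < x
  three-quarters {x} 0<x = by-< (quarter-pos 0<x)
    (trans (solve 1 (λ q → q := ((q :+ q) :+ (q :+ q)) :- (q :+ (q :+ q))) refl (quarter x)) (+-congʳ (four-quarters x)))

  light-sum : ∀ {q x y z u} → 0# < q → (q + q) + (q + q) ≈ u → x < q → y < q → z < q → ¬ x + (y + (z + 0#)) ≈ u
  light-sum {q} {x} {y} {z} 0<q 4q≈u x<q y<q z<q sum≈u = <⇒≱
    (+-pos 0<q (+-nonNeg (<⇒≤ (gap-< x<q)) (+-nonNeg (<⇒≤ (gap-< y<q)) (<⇒≤ (gap-< z<q)))))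
    (≤-reflexive (trans
      (solve 4 (λ q x y z → q :+ ((q :- x) :+ ((q :- y) :+ (q :- z))) :=
          ((q :+ q) :+ (q :+ q)) :- (x :+ (y :+ (z :+ con (0 , 0))))) refl q x y z)
      (trans (+-cong 4q≈u (-‿cong sum≈u)) (-‿inverseʳ _))))

  module _ {i} {I : Set i} where

    infix 4 _≋_
    _≋_ : (I → Carrier) → (I → Carrier) → Set i
    p ≋ q = ∀ k → p k ≈ q k

    mix-cong : ∀ s p {q q′} → q ≋ q′ → mix s p q ≋ mix s p q′
    mix-cong s p q≋ k = +-congˡ (*-congˡ (q≋ k))

    mix-0 : ∀ p q → mix 0# p q ≋ p
    mix-0 p q k = solve 2 (λ p q → (con (1 , 0) :- con (0 , 0)) :* p :+ con (0 , 0) :* q := p) refl (p k) (q k)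

    mix-1 : ∀ p q → mix 1# p q ≋ q
    mix-1 p q k = solve 2 (λ p q → (con (1 , 0) :- con (1 , 0)) :* p :+ con (1 , 0) :* q := q) refl (p k) (q k)

    mix-same : ∀ s p → mix s p p ≋ p
    mix-same s p k = solve 2 (λ s p → (con (1 , 0) :- s) :* p :+ s :* p := p) refl s (p k)

    -- The difference is (s - s′)(q′ - p) + s (q - q′). Its first term is at most twice a quarter of
    -- `δ` and its second at most one quarter, which leaves a quarter to spare.
    mix-close : ∀ {s s′ δ} (p q q′ : I → Carrier) k → 0# < δ → InUnit s →
      ∣ p k ∣≤ 1# → ∣ q′ k ∣≤ 1# → Close (quarter δ) s s′ → Close (quarter δ) (q k) (q′ k) →
      Close δ (mix s p q k) (mix s′ p q′ k)
    mix-close {s} {s′} {δ} p q q′ k 0<δ (0≤s , s≤1) p≤1 q′≤1 s-close q-close = ∣∣≤⇒close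
      (∣+∣≤ (∣*∣≤ (close⇒∣∣≤ s-close) (∣-∣≤ q′≤1 p≤1)) (∣*∣≤ (s≤1 , ≤-trans -s≤0 0≤1) (close⇒∣∣≤ q-close)))
      (<-respˡ-≈ (solve 1 (λ d → let u = con (1 , 0) in d :+ (d :+ d) := d :* (u :+ u) :+ u :* d) refl (quarter δ))
        (three-quarters 0<δ))
      (solve 5 (λ s s′ p q q′ → let u = con (1 , 0) in
          (s :- s′) :* (q′ :- p) :+ s :* (q :- q′)
          := ((u :- s) :* p :+ s :* q) :- ((u :- s′) :* p :+ s′ :* q′))
        refl s s′ (p k) (q k) (q′ k))
      where
      -s≤0 : - s ≤ 0#
      -s≤0 = by-≤ 0≤s (solve 1 (λ s → s := con (0 , 0) :- :- s) refl s)

  module _ {v} {V : Set v} where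

    dirac : V → V → Carrier
    dirac x k with em {P = x ≡ k}
    ... | yes _ = 1#
    ... | no _  = 0#

    dirac-≡ : ∀ x → dirac x x ≡ 1#
    dirac-≡ x with em {P = x ≡ x}
    ... | yes _  = ≡.refl
    ... | no x≢x = contradiction ≡.refl x≢x

    dirac-≢ : ∀ {x k} → x ≢ k → dirac x k ≡ 0#
    dirac-≢ {x} {k} x≢k with em {P = x ≡ k}
    ... | yes x≡k = contradiction x≡k x≢k
    ... | no _    = ≡.refl

    dirac-nonNeg : ∀ x k → 0# ≤ dirac x k
    dirac-nonNeg x k with em {P = x ≡ k}
    ... | yes _ = 0≤1
    ... | no _  = ≤-refl

    dirac-bounded : ∀ x k → ∣ dirac x k ∣≤ 1#
    dirac-bounded x k with em {P = x ≡ k}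
    ... | yes _ = ≤-refl , ≤-trans (by-≤ 0≤1 (solve 0 (con (1 , 0) := con (0 , 0) :- :- con (1 , 0)) refl)) 0≤1
    ... | no _  = 0≤1 , ≤-trans (≤-reflexive (solve 0 (:- con (0 , 0) := con (0 , 0)) refl)) 0≤1

    segment : V → V → Carrier → V → Carrier
    segment x y t = mix t (dirac x) (dirac y)

    segment-∉ : ∀ {x y t k} → k ∉ x ∷ y ∷ [] → segment x y t k ≈ 0#
    segment-∉ {x} {y} {t} {k} k∉
      rewrite dirac-≢ {x} {k} (λ x≡k → k∉ (here (≡.sym x≡k))) | dirac-≢ {y} {k} (λ y≡k → k∉ (there (here (≡.sym y≡k)))) =
      mix-same t (λ _ → 0#) k

    segment-simplex : ∀ {x y t} → x ≢ y → InUnit t → Simplex (x ∷ y ∷ []) (segment x y t)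
    segment-simplex {x} {y} {t} x≢y (0≤t , t≤1) =
      (λ k → +-nonNeg (*-nonNeg (gap-≤ t≤1) (dirac-nonNeg x k)) (*-nonNeg 0≤t (dirac-nonNeg y k))) ,
      (λ k → segment-∉) ,
      total-mass
      where
      total-mass : segment x y t x + (segment x y t y + 0#) ≈ 1#
      total-mass rewrite dirac-≡ x | dirac-≡ y | dirac-≢ x≢y | dirac-≢ (≡.≢-sym x≢y) =
        solve 1 (λ t → let u = con (1 , 0) ; z = con (0 , 0) in
          ((u :- t) :* u :+ t :* z) :+ (((u :- t) :* z :+ t :* u) :+ z) := u) refl t

  -- Uniform radii on the unit square.

  module Tameness {c ℓ} {C : Set c} (Sample : Carrier → Carrier → C → Set ℓ) where

    Box : Carrier → Carrier → Carrier → C → Set ℓ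
    Box t s δ X = ∃ λ t′ → ∃ λ s′ → Close δ t t′ × Close δ s s′ × Sample t′ s′ X

    Tame : Carrier → Carrier → Carrier → Set (c ⊔ ℓ)
    Tame t s δ = Flat (Box t s δ)

    tame-shrink : ∀ {t t′ s s′ δ δ′} → δ′ + δ′ ≤ δ → Close δ′ t t′ → Close δ′ s s′ →
                  Tame t s δ → Tame t′ s′ δ′
    tame-shrink 2δ′≤δ t-close s-close = flat-⊆ λ (t″ , s″ , t′t″ , s′s″ , sample) →
      t″ , s″ , close-trans 2δ′≤δ t-close t′t″ , close-trans 2δ′≤δ s-close s′s″ , sample

    -- A Lebesgue number of the square comes from the one of the interval used twice: along `s` for
    -- fixed `t`, then along `t` for radii already uniform in `s`.
    tame-uniformly : (∀ t s → InUnit t → InUnit s → ∃ λ δ → 0# < δ × Tame t s δ) →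
      ∃ λ δ → 0# < δ × (∀ t → InUnit t → ∀ s → InUnit s → Tame t s δ)
    tame-uniformly local = lebesgue-number (λ t δ → ∀ s → InUnit s → Tame t s δ)
      (λ 0<δ 2δ≤ t-close tame s s∈ → tame-shrink 2δ≤ t-close (close-≈ 0<δ refl) (tame s s∈))
      λ t t∈ → lebesgue-number (Tame t)
        (λ 0<δ 2δ≤ s-close tame → tame-shrink 2δ≤ (close-≈ 0<δ refl) s-close tame)
        (λ s s∈ → local t s t∈ s∈)

  -- Colouring the disk through the triangulation.

  module _ {v c} {V : Set v} {C : Set c} (G : Polygon V) (T : List (Triangle V))
           (triangulation : IsTriangulation ℝ G T) (colour : V → C)
           (¬tricolor : ¬ ∃ λ t → t ∈ T × Tricolor colour t) where

    open IsTriangulation triangulation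
    open Homeomorphism homeomorphism
    open Reduction {C = C} (λ x y → em)

    Space : Set v
    Space = Σ (V → Carrier) ∣ IsTriangle T ∣

    DiskPoint : Set
    DiskPoint = Σ (Fin 2 → Carrier) Disk

    -- The threshold of heaviness. A quarter is less than a third, so three coordinates with sum one
    -- cannot all lie below it.
    θ : Carrier
    θ = quarter 1#

    0<θ : 0# < θ
    0<θ = quarter-pos 0<1

    heavy-vertex : (p : Space) → ∃ λ x → θ ≤ proj₁ p x
    heavy-vertex (p , _ , triangle {t} _ , _ , _ , sum≈1) with em {P = ∃ λ x → θ ≤ p x}
    ... | yes heavy  = heavy
    ... | no ¬heavy = contradiction sum≈1
      (light-sum 0<θ (four-quarters 1#) (light v₀) (light v₁) (light v₂))
      where
      open Triangle t using (v₀; v₁; v₂)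
      light : ∀ x → p x < θ
      light x = ≰⇒> λ θ≤ → ¬heavy (x , θ≤)

    Colours : DiskPoint → C → Set (v ⊔ c)
    Colours d X = ∃ λ x → θ ≤ proj₁ (from d) x × colour x ≡ X

    colourAt : DiskPoint → C
    colourAt d = colour (proj₁ (heavy-vertex (from d)))

    colourAt-colours : ∀ d → Colours d (colourAt d)
    colourAt-colours d = _ , proj₂ (heavy-vertex (from d)) , ≡.refl

    Supported : (V → Carrier) → C → Set (v ⊔ c)
    Supported p X = ∃ λ x → 0# < p x × colour x ≡ X

    -- The support of a point lies in a single triangle of `T`, which is not tricolor.
    supported-flat : (p : Space) → Flat (Supported (proj₁ p))
    supported-flat (p , _ , triangle {t} t∈T , _ , outside , _) =
      flat-⊆ member (flat-triple λ tricolor → ¬tricolor (t , t∈T , tricolor))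
      where
      member : ∀ {X} → Supported p X → X ∈ map colour (vertices t)
      member (x , 0<p , ≡.refl) with em {P = x ∈ vertices t}
      ... | yes x∈ = ∈-map⁺ colour x∈
      ... | no x∉  = contradiction (sym (outside x x∉)) (proj₂ 0<p)

    Around : Carrier → DiskPoint → C → Set (v ⊔ c)
    Around δ d X = ∃ λ d′ → Near δ (proj₁ d) (proj₁ d′) × Colours d′ X

    -- With continuity applied at tolerance `θ`, a vertex that is heavy at a nearby point still has
    -- a positive coordinate at `d`. Hence the colours seen near `d` all belong to one triangle.
    around-flat : ∀ d → ∃ λ δ → 0# < δ × Flat (Around δ d)
    around-flat d = case from-continuous d θ 0<θ of λ (δ , 0<δ , near) →
      δ , 0<δ , flat-⊆ (λ (d′ , n , x , θ≤ , eq) → x , close⇒pos θ≤ (near d′ n x) , eq) (supported-flat (from d))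

    to-cong : ∀ p p′ → proj₁ p ≋ proj₁ p′ → proj₁ (to p) ≋ proj₁ (to p′)
    to-cong p p′ p≋p′ k = close-arbitrarily⇒≈ λ δ 0<δ →
      let η , 0<η , near = to-continuous p δ 0<δ in near p′ (λ x → close-≈ 0<η (p≋p′ x)) k

    from-cong : ∀ d d′ → proj₁ d ≋ proj₁ d′ → proj₁ (from d) ≋ proj₁ (from d′)
    from-cong d d′ d≋d′ k = close-arbitrarily⇒≈ λ δ 0<δ →
      let η , 0<η , near = from-continuous d δ 0<δ in near d′ (λ x → close-≈ 0<η (d≋d′ x)) k

    from-to : ∀ d p → proj₁ d ≋ proj₁ (to p) → proj₁ (from d) ≋ proj₁ p
    from-to d p d≋ k = trans (from-cong d (to p) d≋ k) (from∘to p k)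

    Edge : V → V → Set v
    Edge x y = IsEdge G (x ∷ y ∷ [])

    edge-≢ : ∀ {x y} → Edge x y → x ≢ y
    edge-≢ (edge corners∼) with (x≢y ∷ _) ∷ _ ← unique-∼ corners∼ (Polygon.distinct G) = x≢y

    -- The boundary condition of the triangulation puts the points of an edge of `G` into the space
    -- of `T`.
    edge-point : ∀ {x y} → x ≢ y → Edge x y → ∀ t → InUnit t → ∃ λ (p : Space) → proj₁ p ≋ segment x y t
    edge-point {x} {y} x≢y e t t∈ =
      (segment x y t , proj₁ (Equivalence.to (boundary _) (_ , e , segment-simplex x≢y t∈))) , λ _ → refl

    source : ∀ {x y} → x ≢ y → Edge x y → ∃ λ (p : Space) → proj₁ p ≋ dirac x
    source {x} {y} x≢y e = case edge-point x≢y e 0# 0∈ of λ (p , p≋) →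
      p , λ k → trans (p≋ k) (mix-0 (dirac x) (dirac y) k)

    target : ∀ {x y} → x ≢ y → Edge x y → ∃ λ (p : Space) → proj₁ p ≋ dirac y
    target {x} {y} x≢y e = case edge-point x≢y e 1# 1∈ of λ (p , p≋) →
      p , λ k → trans (p≋ k) (mix-1 (dirac x) (dirac y) k)

    -- A vertex off the edge has coordinate zero, hence is not heavy.
    colour-on-segment : ∀ {x y t X} d p → proj₁ d ≋ proj₁ (to p) → proj₁ p ≋ segment x y t →
                        Colours d X → X ∈ colour x ∷ colour y ∷ []
    colour-on-segment {x} {y} {t} d p d≋ p≋ (k , θ≤ , ≡.refl) with em {P = k ∈ x ∷ y ∷ []}
    ... | yes k∈ = ∈-map⁺ colour k∈
    ... | no k∉  = contradiction
      (≤-trans θ≤ (≤-reflexive (trans (from-to d p d≋ k) (trans (p≋ k) (segment-∉ k∉))))) (<⇒≱ 0<θ)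

    colour-on-vertex : ∀ {x X} d p → proj₁ d ≋ proj₁ (to p) → proj₁ p ≋ dirac x →
                       Colours d X → X ≡ colour x
    colour-on-vertex {x} d p d≋ p≋ colours = collapse
      -- A vertex is the degenerate segment from `x` to `x`; the parameter 0 is an arbitrary choice.
      (colour-on-segment {x} {x} {0#} d p d≋ (λ k → trans (p≋ k) (sym (mix-same 0# (dirac x) k))) colours)
      where
      collapse : ∀ {X Y : C} → X ∈ Y ∷ Y ∷ [] → X ≡ Y
      collapse (here eq)         = eq
      collapse (there (here eq)) = eq

    -- Lifting the boundary along rays from a corner.

    module _ {x₀ : V} (v₀ : Space) (v₀≋ : proj₁ v₀ ≋ dirac x₀) where

      base : Fin 2 → Carrier
      base = proj₁ (to v₀)

      -- Since the disk is convex, each of its points is joined to the base point by a segment that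
      -- varies continuously with the point.
      ray : Space → ∃ InUnit → DiskPoint
      ray p (s , s∈) = mix s base (proj₁ (to p)) , disk-convex base (proj₁ (to p)) s∈ (proj₂ (to v₀)) (proj₂ (to p))

      spoke : Space → ∃ InUnit → C
      spoke p s = colourAt (ray p s)

      tip : Space → C
      tip p = spoke p (1# , 1∈)

      ray-0 : ∀ p → proj₁ (ray p (0# , 0∈)) ≋ proj₁ (to v₀)
      ray-0 p k = mix-0 base (proj₁ (to p)) k

      ray-1 : ∀ p → proj₁ (ray p (1# , 1∈)) ≋ proj₁ (to p)
      ray-1 p k = mix-1 base (proj₁ (to p)) k

      -- The first letter of every lift is `colour x₀`. As a colour of the common start of the rays,
      -- it can enter the degenerate triangles at parameter 0.
      ray-0-colours : ∀ p → Colours (ray p (0# , 0∈)) (colour x₀)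
      ray-0-colours p = x₀ , ≤-trans (<⇒≤ (quarter-< 0<1)) (≤-reflexive (sym mass)) , ≡.refl
        where
        mass : proj₁ (from (ray p (0# , 0∈))) x₀ ≈ 1#
        mass = trans (from-to (ray p (0# , 0∈)) v₀ (ray-0 p) x₀) (trans (v₀≋ x₀) (reflexive (dirac-≡ x₀)))

      module _ {δ} (P : Star (UnitStep δ) (0# , 0∈) (1# , 1∈)) where

        -- The reduced walk read along the segment of the disk from the
        -- base point to the image of p.

        lift : Space → List C
        lift p = pushAlong (spoke p) P (push (spoke p (0# , 0∈)) (colour x₀ ∷ []))

        lift-reduced : ∀ p → Reduced (tip p) (lift p)
        lift-reduced p = pushAlong-reduced (spoke p) P (push-reduced (spoke p (0# , 0∈)) one)

        -- The ray to the base point never leaves it, and `x₀` is the only heavy vertex there.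
        lift-base : ∀ p → proj₁ p ≋ dirac x₀ → lift p ≡ colour x₀ ∷ []
        lift-base p p≋ = ≡.trans
          (≡.cong (pushAlong (spoke p) P) (≡.trans (≡.cong (λ X → push X (colour x₀ ∷ [])) (constant (0# , 0∈))) (push-top one)))
          (pushAlong-constant constant P one)
          where
          constant : ∀ s → spoke p s ≡ colour x₀
          constant s = colour-on-vertex (ray p s) p
            (λ k → trans (mix-cong (proj₁ s) base to-p k) (trans (mix-same (proj₁ s) base k) (sym (to-p k)))) p≋ (colourAt-colours (ray p s))
            where
            to-p : proj₁ (to p) ≋ base
            to-p = to-cong p v₀ λ k → trans (p≋ k) (sym (v₀≋ k))

      module _ {x y} (x≢y : x ≢ y) (e : Edge x y) where

        -- All representatives of a point are sampled, because colourAt need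
        -- not respect equality of coordinates.

        Sample : Carrier → Carrier → C → Set (v ⊔ c)
        Sample t s X = ∃ λ p → ∃ λ d →
          proj₁ p ≋ segment x y t × proj₁ d ≋ mix s base (proj₁ (to p)) × Colours d X

        open Tameness Sample

        -- This is continuity of the ray in both parameters. `mix-close` is used twice, hence the
        -- quarters: on the edge, where `t` moves the endpoint by less than `δ₂`, and on the ray,
        -- where `s` and the image of that endpoint move together.
        box-near : ∀ {t s δ δ₁ δ₂} p (s∈ : InUnit s) → InUnit t → proj₁ p ≋ segment x y t →
          0# < δ₁ → 0# < δ₂ →
          (∀ q → Near δ₂ (proj₁ p) (proj₁ q) → Near (quarter δ₁) (proj₁ (to p)) (proj₁ (to q))) →
          δ ≤ quarter δ₁ → δ ≤ quarter δ₂ →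
          ∀ {X} → Box t s δ X → Around δ₁ (ray p (s , s∈)) X
        box-near {t} {s} {δ} {δ₁} {δ₂} p s∈ t∈ p≋ 0<δ₁ 0<δ₂ near δ≤₁ δ≤₂ (t′ , s′ , tt′ , ss′ , q , d , q≋ , d≋ , colours) =
          d , d-near , colours
          where
          q-near : Near δ₂ (proj₁ p) (proj₁ q)
          q-near k = close-respˡ (sym (p≋ k)) (close-respʳ (sym (q≋ k))
            (mix-close (dirac x) (dirac y) (dirac y) k 0<δ₂ t∈ (dirac-bounded x k) (dirac-bounded y k)
              (close-≤ δ≤₂ tt′) (close-≈ (quarter-pos 0<δ₂) refl)))

          d-near : Near δ₁ (proj₁ (ray p (s , s∈))) (proj₁ d)
          d-near k = close-respʳ (sym (d≋ k))
            (mix-close base (proj₁ (to p)) (proj₁ (to q)) k 0<δ₁ s∈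
              (disk-bounded base (proj₂ (to v₀)) k) (disk-bounded (proj₁ (to q)) (proj₂ (to q)) k)
              (close-≤ δ≤₁ ss′) (near q q-near k))

        edge-tame : ∀ t s → InUnit t → InUnit s → ∃ λ δ → 0# < δ × Tame t s δ
        edge-tame t s t∈ s∈ =
          case edge-point x≢y e t t∈ of λ (p , p≋) →
          case around-flat (ray p (s , s∈)) of λ (δ₁ , 0<δ₁ , flat) →
          case to-continuous p (quarter δ₁) (quarter-pos 0<δ₁) of λ (δ₂ , 0<δ₂ , near) →
          case common-bound (quarter-pos 0<δ₁) (quarter-pos 0<δ₂) of λ (δ , 0<δ , δ≤₁ , δ≤₂) →
          δ , 0<δ , flat-⊆ (box-near p s∈ t∈ p≋ 0<δ₁ 0<δ₂ near δ≤₁ δ≤₂) flat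

        module _ {δ} (0<δ : 0# < δ) (tame : ∀ t → InUnit t → ∀ s → InUnit s → Tame t s δ)
                 {δ′} (δ′≤δ : δ′ ≤ δ) (P : Star (UnitStep δ′) (0# , 0∈) (1# , 1∈)) where

          -- The spokes of `p` and `p′` are the rails of a ladder. All letters of the square at `s`
          -- are sampled in the box around `t` and `s`, so tameness makes both of its triangles
          -- degenerate. The first rung is absorbed by a degenerate triangle with `colour x₀`.
          lift-near : ∀ {t a b} → InUnit t → Close δ t a → Close δ t b → ∀ p p′ →
            proj₁ p ≋ segment x y a → proj₁ p′ ≋ segment x y b → lift P p′ ≡ push (tip p′) (lift P p)
          lift-near {t} {a} {b} t∈ ta tb p p′ p≋ p′≋ = ≡.sym (≡.trans
            (pushAlong-homotopy (λ {s} {s′} → square {s} {s′}) P (push-reduced (spoke p (0# , 0∈)) one))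
            (≡.cong (pushAlong (spoke p′) P)
              (push-degenerate one (tame t t∈ 0# 0∈ _ _ _
                (a , 0# , ta , close-≈ 0<δ refl , p , ray p (0# , 0∈) , p≋ , (λ _ → refl) , ray-0-colours p)
                (box ta p p≋ (0# , 0∈) (close-≈ 0<δ refl))
                (box tb p′ p′≋ (0# , 0∈) (close-≈ 0<δ refl))))))
            where
            box : ∀ {s a} → Close δ t a → ∀ p → proj₁ p ≋ segment x y a →
                  (s′ : ∃ InUnit) → Close δ s (proj₁ s′) → Box t s δ (spoke p s′)
            box ta p p≋ s′ ss′ = _ , _ , ta , ss′ , p , ray p s′ , p≋ , (λ _ → refl) , colourAt-colours (ray p s′)

            square : ∀ {s s′} → UnitStep δ′ s s′ →
              Degenerate (spoke p s) (spoke p′ s) (spoke p′ s′) × Degenerate (spoke p s) (spoke p s′) (spoke p′ s′)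
            square {s , s∈} {s′} ss′ =
              tame t t∈ s s∈ _ _ _ (box ta p p≋ _ here-s) (box tb p′ p′≋ _ here-s) (box tb p′ p′≋ s′ there-s) ,
              tame t t∈ s s∈ _ _ _ (box ta p p≋ _ here-s) (box ta p p≋ s′ there-s) (box tb p′ p′≋ s′ there-s)
              where
              here-s = close-≈ 0<δ refl
              there-s = close-≤ δ′≤δ ss′

          Lifts : Carrier → Carrier → Set (v ⊔ c)
          Lifts a b = InUnit a → InUnit b → ∀ p p′ →
            proj₁ p ≋ segment x y a → proj₁ p′ ≋ segment x y b → lift P p′ ≡ push (tip p′) (lift P p)

          -- Cousin's lemma along the edge, with `lift-near` as its local hypothesis. At the far end
          -- only the colour of `y` occurs, which identifies the appended letter.
          lift-edge : ∀ p p′ → proj₁ p ≋ dirac x → proj₁ p′ ≋ dirac y → lift P p′ ≡ push (colour y) (lift P p)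
          lift-edge p p′ p≋ p′≋ = ≡.subst (λ X → lift P p′ ≡ push X (lift P p))
            (colour-on-vertex (ray p′ (1# , 1∈)) p′ (ray-1 p′) p′≋ (colourAt-colours (ray p′ (1# , 1∈))))
            (cousin Lifts additive
              (λ t t∈ → δ , 0<δ , λ a b _ _ _ _ at tb _ _ → lift-near t∈ (close-sym at) tb)
              0∈ 1∈ p p′ (λ k → trans (p≋ k) (sym (mix-0 (dirac x) (dirac y) k))) (λ k → trans (p′≋ k) (sym (mix-1 (dirac x) (dirac y) k))))
            where
            on-edge : ∀ {t} p → proj₁ p ≋ segment x y t → tip p ∈ colour x ∷ colour y ∷ []
            on-edge p p≋ = colour-on-segment (ray p (1# , 1∈)) p (ray-1 p) p≋ (colourAt-colours (ray p (1# , 1∈)))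

            -- Only two colours occur on an edge, so that the letter at an
            -- intermediate point can be dropped.
            additive : ∀ {a b c} → a ≤ b → b ≤ c → Lifts a b → Lifts b c → Lifts a c
            additive {a} {b} {c} a≤b b≤c ab bc a∈ c∈ p p′ p≋ p′≋ =
              let b∈ = ≤-trans (proj₁ a∈) a≤b , ≤-trans b≤c (proj₂ c∈) in
              case edge-point x≢y e b b∈ of λ (q , q≋) →
              ≡.trans (bc b∈ c∈ q p′ q≋ p′≋) (≡.trans (≡.cong (push (tip p′)) (ab a∈ b∈ p q p≋ q≋))
                   (push-degenerate (lift-reduced P p) (flat-pair (colour x) (colour y) _ _ _ (on-edge p p≋) (on-edge q q≋) (on-edge p′ p′≋))))

      -- The chain `P` is chosen after the bound on its mesh, so that one fine chain can serve all
      -- edges of the polygon.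
      Tracks : List C → V → V → Set (v ⊔ c)
      Tracks Xs x y = ∃ λ δ → 0# < δ ×
        (∀ δ′ → δ′ ≤ δ → (P : Star (UnitStep δ′) (0# , 0∈) (1# , 1∈)) → ∀ p p′ →
          proj₁ p ≋ dirac x → proj₁ p′ ≋ dirac y → lift P p′ ≡ pushes (lift P p) Xs)

      edge-tracks : ∀ {x y} → x ≢ y → Edge x y → Tracks [ colour y ] x y
      edge-tracks x≢y e =
        case Tameness.tame-uniformly (Sample x≢y e) (edge-tame x≢y e) of λ (δ , 0<δ , tame) →
        δ , 0<δ , λ δ′ δ′≤δ → lift-edge x≢y e 0<δ tame δ′≤δ

      walk-tracks : ∀ x ys z → Linked Edge (x ∷ ys ∷ʳ z) → Tracks (map colour (ys ∷ʳ z)) x z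
      walk-tracks x []       z (e ∷ _)  = edge-tracks (edge-≢ e) e
      walk-tracks x (y ∷ ys) z (e ∷ es) =
        case edge-tracks (edge-≢ e) e of λ (δ₁ , 0<δ₁ , first) →
        case walk-tracks y ys z es of λ (δ₂ , 0<δ₂ , rest) →
        case common-bound 0<δ₁ 0<δ₂ of λ (δ , 0<δ , δ≤₁ , δ≤₂) →
        case target (edge-≢ e) e of λ (q , q≋) →
        δ , 0<δ , λ δ′ δ′≤δ P p p′ p≋ p′≋ → ≡.trans
          (rest δ′ (≤-trans δ′≤δ δ≤₂) P q p′ q≋ p′≋)
          (≡.cong (λ s → pushes s (map colour (ys ∷ʳ z))) (first δ′ (≤-trans δ′≤δ δ≤₁) P p q p≋ q≋))

    -- The tour of the boundary begins and ends at `v₀`, whose lift is a single letter. So the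
    -- letters of the boundary push this one-letter walk to itself, and `contractible-closed`
    -- applies.
    corners-contractible : ∀ w → corners G ≡ w → Contractible (map colour w)
    corners-contractible []       eq = contradiction (≡.subst (λ w → 3 ℕ.≤ length w) eq (Polygon.3≤length G)) λ ()
    corners-contractible (_ ∷ []) eq = contradiction (≡.subst (λ w → 3 ℕ.≤ length w) eq (Polygon.3≤length G)) λ { (ℕ.s≤s ()) }
    corners-contractible (x₀ ∷ x₁ ∷ xs) eq =
      case source (edge-≢ first-edge) first-edge of λ (v₀ , v₀≋) →
      case walk-tracks v₀ v₀≋ x₀ (x₁ ∷ xs) x₀ edges of λ (δ , 0<δ , walk) →
      case partition 0<δ of λ P →
      case lift-base v₀ v₀≋ P v₀ v₀≋ of λ start →
      contractible-closed (colour x₀) (map colour (x₁ ∷ xs)) (≡.trans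
        (≡.cong₂ pushes (≡.sym start) (≡.sym (map-++ colour (x₁ ∷ xs) [ x₀ ])))
        (≡.trans (≡.sym (walk δ ≤-refl P v₀ v₀ v₀≋ v₀≋)) start))
      where
      -- `mid` keeps the corners already passed, from which the rotation bringing `x` to the front
      -- is written down. After the last corner the tour returns to `x₀`.
      edges-from : ∀ mid x ys → corners G ≡ x₀ ∷ mid ++ x ∷ ys → Linked Edge (x ∷ ys ∷ʳ x₀)
      edges-from mid x [] eq =
        edge (≡.subst (_∼ (x ∷ x₀ ∷ mid)) (≡.sym eq) (rotation (x₀ ∷ mid) [ x ])) ∷ [-]
      edges-from mid x (y ∷ ys) eq =
        edge (≡.subst (_∼ (x ∷ y ∷ ys ++ x₀ ∷ mid)) (≡.sym eq) (rotation (x₀ ∷ mid) (x ∷ y ∷ ys))) ∷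
        edges-from (mid ∷ʳ x) y ys (≡.trans eq (≡.cong (x₀ ∷_) (≡.sym (++-assoc mid [ x ] (y ∷ ys)))))

      first-edge : Edge x₀ x₁
      first-edge = edge (≡.subst (_∼ (x₀ ∷ x₁ ∷ xs)) (≡.sym eq) ∼-refl)

      edges : Linked Edge (x₀ ∷ x₁ ∷ xs ∷ʳ x₀)
      edges = first-edge ∷ edges-from [] x₁ xs eq


theorem15 : (∀ {ℓ} → ExcludedMiddle ℓ) →
    (ℝ : CompleteOrderedField) →
    ∀ {v c} {V : Set v} {C : Set c}
    (G : Polygon V) (T : List (Triangle V)) →
    IsTriangulation ℝ G T →
    (colour : V → C) →
    ¬ Contractible (word colour G) →
    ∃ λ t → t ∈ T × Tricolor colour t
theorem15 em ℝ G T triangulation colour ¬contractible with em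
... | yes tricolor  = tricolor
... | no ¬tricolor = contradiction
  (corners-contractible em ℝ G T triangulation colour ¬tricolor (corners G) ≡.refl) ¬contractible
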